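{- For every non-empty list $\Omega$ of atoms, the posets $\mathrm{Frm}_\Omega$ and $\mathrm{Ctx}_\Omega$ are lattices.
   Context: Formulas are built from atoms ($p,q,\dots$) by a binary product: every formula is an atom or $A\bullet B$. A context is a finite (possibly empty) list of formulas; commas denote concatenation. The frontier $\mathrm{fr}$ of a formula is its ordered list of atom occurrences: $\mathrm{fr}(p)=p$, $\mathrm{fr}(A\bullet B)=\mathrm{fr}(A),\mathrm{fr}(B)$; the frontier of a context is the concatenation of the frontiers of its formulas. The sequent calculus has exactly four rules (no weakening, contraction or exchange): ($\bullet L$) from $A,B,\Delta\vdash C$ infer $A\bullet B,\Delta\vdash C$ (the product must be leftmost); ($\bullet R$) from $\Gamma\vdash A$ and $\Delta\vdash B$ infer $\Gamma,\Delta\vdash A\bullet B$; ($id$) $A\vdash A$; ($cut$) from $\Theta\vdash A$ and $\Gamma,A,\Delta\vdash B$ infer $\Gamma,\Theta,\Delta\vdash B$; derivable means conclusion of a finite derivation tree with no undischarged premises. The Tamari order $\le$ on formulas is the least preorder with $(A\bullet B)\bullet C\le A\bullet(B\bullet C)$ and $A_1\le A_2$, $B_1\le B_2$ implying $A_1\bullet B_1\le A_2\bullet B_2$. The substitution order on contexts is the least relation $\le$ such that: (1) if $\Gamma\vdash A$ is derivable then $\Gamma\le A$ (the one-element context); (2) $\cdot\le\cdot$ for the empty context; (3) if $\Gamma_1\le\Gamma_2$ and $\Theta_1\le\Theta_2$ then $(\Gamma_1,\Theta_1)\le(\Gamma_2,\Theta_2)$. $\mathrm{Frm}_\Omega$ is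 the set of formulas with frontier $\Omega$ under the Tamari order, and $\mathrm{Ctx}_\Omega$ is the set of contexts with frontier $\Omega$ under the substitution order. -}

module Defs where

open import Data.List.Base using (List; []; _∷_; [_]; _++_; concatMap)
open import Data.Product.Base using (Σ-syntax; ∃₂; proj₁)
open import Function.Base using (_on_)
open import Level using (Level; _⊔_)
open import Relation.Binary.Core using (Rel)
open import Relation.Binary.Lattice.Structures using (IsLattice)
open import Relation.Binary.PropositionalEquality.Core using (_≡_)

private
  variable
    a ℓ₁ ℓ₂ : Level
    Atom : Set a

infixr 7 _•_
infix  4 _⊢_ _≤Tamari_ _≤subst_

data Formula (Atom : Set a) : Set a where
  atom : Atom → Formula Atom
  _•_  : Formula Atom → Formula Atom → Formula Atom

Context : Set a → Set a
Context Atom = List (Formula Atom)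

fr : Formula Atom → List Atom
fr (atom p) = [ p ]
fr (A • B)  = fr A ++ fr B

frᶜ : Context Atom → List Atom
frᶜ = concatMap fr

data _⊢_ {Atom : Set a} : Context Atom → Formula Atom → Set a where
  •L  : ∀ {A B Δ C} → A ∷ B ∷ Δ ⊢ C → A • B ∷ Δ ⊢ C
  •R  : ∀ {Γ Δ A B} → Γ ⊢ A → Δ ⊢ B → Γ ++ Δ ⊢ A • B
  id  : ∀ {A} → [ A ] ⊢ A
  cut : ∀ {Γ Θ Δ A B} → Θ ⊢ A → Γ ++ A ∷ Δ ⊢ B → Γ ++ Θ ++ Δ ⊢ B

data _≤Tamari_ {Atom : Set a} : Rel (Formula Atom) a where
  refl  : ∀ {A} → A ≤Tamari A
  trans : ∀ {A B C} → A ≤Tamari B → B ≤Tamari C → A ≤Tamari C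
  assoc : ∀ {A B C} → (A • B) • C ≤Tamari A • (B • C)
  mono  : ∀ {A₁ A₂ B₁ B₂} → A₁ ≤Tamari A₂ → B₁ ≤Tamari B₂ → A₁ • B₁ ≤Tamari A₂ • B₂

data _≤subst_ {Atom : Set a} : Rel (Context Atom) a where
  derivable : ∀ {Γ A} → Γ ⊢ A → Γ ≤subst [ A ]
  empty     : [] ≤subst []
  concat    : ∀ {Γ₁ Γ₂ Θ₁ Θ₂} → Γ₁ ≤subst Γ₂ → Θ₁ ≤subst Θ₂ → Γ₁ ++ Θ₁ ≤subst Γ₂ ++ Θ₂

-- Elements of Frm Ω and Ctx Ω are compared through their first component
-- only: Atom is an arbitrary type, so proofs of equality between lists of
-- atoms need not be unique.

Frm : {Atom : Set a} → List Atom → Set a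
Frm {Atom = Atom} Ω = Σ[ A ∈ Formula Atom ] fr A ≡ Ω

Ctx : {Atom : Set a} → List Atom → Set a
Ctx {Atom = Atom} Ω = Σ[ Γ ∈ Context Atom ] frᶜ Γ ≡ Ω

module _ {Atom : Set a} (Ω : List Atom) where

  FrmEq FrmOrder : Rel (Frm Ω) a
  FrmEq    = _≡_ on proj₁
  FrmOrder = _≤Tamari_ on proj₁

  CtxEq CtxOrder : Rel (Ctx Ω) a
  CtxEq    = _≡_ on proj₁
  CtxOrder = _≤subst_ on proj₁

FormsLattice : {X : Set a} → Rel X ℓ₁ → Rel X ℓ₂ → Set (a ⊔ ℓ₁ ⊔ ℓ₂)
FormsLattice _≈_ _≤_ = ∃₂ λ _∨_ _∧_ → IsLattice _≈_ _≤_ _∨_ _∧_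

{-# OPTIONS --safe #-}

-- A formula is determined by its first atom p and by the context Δ of right
-- factors along its left spine, so Frm (p ∷ Ω) ≅ Ctx Ω, and this is an order
-- isomorphism.  A context with frontier p ∷ Ω is then a context Δ ++ Γ with
-- frontier Ω together with the cut point between Δ and Γ (its first formula
-- being p applied to Δ); the substitution order amounts to the order on
-- Δ ++ Γ and on the size of Δ.  Going down in the order preserves cut points,
-- so by induction on Ω meets are obtained by taking the meet of the
-- underlying contexts and the smaller cut point, and joins by taking the join
-- and its least cut point beyond both given ones.
module Submission where

open import Data.Empty.Polymorphic using (⊥)
open import Data.List.Base using (List; []; _∷_; [_]; _++_; foldl; length)
open import Data.List.Properties
  using (++-assoc; ++-identityʳ; concatMap-++; foldl-++; foldl-∷ʳ; length-++; ∷-injective;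
         ∷-injectiveˡ)
open import Data.Nat.Base using (ℕ; zero; suc; _+_; _∸_; _⊔_; _≤_; z≤n)
open import Data.Nat.Properties
  using (≤-trans; ≤-antisym; ≤-reflexive; ≤-total; m≤m+n; m≤n+m∸n;
         m≤n+o⇒m∸n≤o; +-identityʳ; +-monoʳ-≤; +-cancelˡ-≤; m≤m⊔n; m≤n⊔m; ⊔-lub)
open import Data.Product.Base using (_×_; _,_; ∃; ∃₂; proj₁; proj₂)
open import Data.Sum.Base using (inj₁; inj₂)
open import Function.Base using (flip; _on_)
open import Level using (Level)
open import Relation.Binary.Core using (Rel)
open import Relation.Binary.Structures using (IsPartialOrder)
open import Relation.Binary.PropositionalEquality as ≡
  using (_≡_; _≢_; refl; sym; cong; cong₂; subst; module ≡-Reasoning)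
open import Relation.Nullary.Negation using (¬_; contradiction)
open import Defs

private
  variable
    a ℓ : Level
    Atom : Set a
    A B C : Formula Atom
    Γ Δ Θ Γ₁ Γ₂ Δ₁ Δ₂ : Context Atom

-- Lattices from greatest lower and least upper bounds

IsGLB : {X : Set a} → Rel X ℓ → X → X → X → Set _
IsGLB _≤_ x y z = z ≤ x × z ≤ y × ∀ w → w ≤ x → w ≤ y → w ≤ z

GLB LUB : {X : Set a} → Rel X ℓ → X → X → Set _
GLB _≤_ x y = ∃ (IsGLB _≤_ x y)
LUB _≤_     = GLB (flip _≤_)

GLB-sym : {X : Set a} {_≤_ : Rel X ℓ} {x y : X} → GLB _≤_ x y → GLB _≤_ y x
GLB-sym (z , z≤x , z≤y , greatest) = z , z≤y , z≤x , λ w w≤y w≤x → greatest w w≤x w≤y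

-- Comparable elements lie in the same fibre of `f`, so bounds found in the whole of `X` stay in the
-- fibre.
fibreLattice : {X I : Set a} {_≤_ : Rel X ℓ} (f : X → I) (i : I) →
  IsPartialOrder _≡_ _≤_ →
  (∀ {x y} → x ≤ y → f x ≡ f y) →
  (∀ {x y} → f x ≡ f y → GLB _≤_ x y) →
  (∀ {x y} → f x ≡ f y → LUB _≤_ x y) →
  FormsLattice {X = ∃ λ x → f x ≡ i} (_≡_ on proj₁) (_≤_ on proj₁)
fibreLattice {_≤_ = _≤_} f i po f-resp glb lub = _∨_ , _∧_ , record
  { isPartialOrder = record
    { isPreorder = record
      { isEquivalence = record
        { refl = refl ; sym = sym ; trans = ≡.trans }
      ; reflexive = po.reflexive
      ; trans     = po.trans
      }
    ; antisym = po.antisym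
    }
  ; supremum = λ x y → let _ , x≤s , y≤s , least = join x y in
                        x≤s , y≤s , λ z → least (proj₁ z)
  ; infimum  = λ x y → let _ , m≤x , m≤y , greatest = meet x y in
                        m≤x , m≤y , λ z → greatest (proj₁ z)
  }
  where
  module po = IsPartialOrder po

  Fibre = ∃ λ x → f x ≡ i

  meet : (x y : Fibre) → GLB _≤_ (proj₁ x) (proj₁ y)
  meet (_ , fx) (_ , fy) = glb (≡.trans fx (sym fy))

  join : (x y : Fibre) → LUB _≤_ (proj₁ x) (proj₁ y)
  join (_ , fx) (_ , fy) = lub (≡.trans fx (sym fy))

  _∧_ _∨_ : Fibre → Fibre → Fibre
  x ∧ y = let m , m≤x , _ = meet x y in m , ≡.trans (f-resp m≤x) (proj₂ x)
  x ∨ y = let s , x≤s , _ = join x y in s , ≡.trans (sym (f-resp x≤s)) (proj₂ x)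

-- Left spines

first : Formula Atom → Atom
first (atom p) = p
first (A • _)  = first A

spine : Formula Atom → Context Atom
spine (atom _) = []
spine (A • B)  = spine A ++ [ B ]

infixl 6 _•⋆_

-- Left-nested product; `atom p •⋆_` inverts `spine` on formulas with first atom `p`.
_•⋆_ : Formula Atom → Context Atom → Formula Atom
_•⋆_ = foldl _•_

first-•⋆ : ∀ (A : Formula Atom) Γ → first (A •⋆ Γ) ≡ first A
first-•⋆ A []      = refl
first-•⋆ A (B ∷ Γ) = first-•⋆ (A • B) Γ

spine-•⋆ : ∀ (A : Formula Atom) Γ → spine (A •⋆ Γ) ≡ spine A ++ Γ
spine-•⋆ A []      = sym (++-identityʳ _)
spine-•⋆ A (B ∷ Γ) = ≡.trans (spine-•⋆ (A • B) Γ) (++-assoc (spine A) [ B ] Γ)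

frᶜ-++ : ∀ (Γ Δ : Context Atom) → frᶜ (Γ ++ Δ) ≡ frᶜ Γ ++ frᶜ Δ
frᶜ-++ = concatMap-++ fr

fr-•⋆ : ∀ (A : Formula Atom) Γ → fr (A •⋆ Γ) ≡ frᶜ (A ∷ Γ)
fr-•⋆ A []      = sym (++-identityʳ _)
fr-•⋆ A (B ∷ Γ) = ≡.trans (fr-•⋆ (A • B) Γ) (++-assoc (fr A) (fr B) (frᶜ Γ))

-- Unfolding the first formula strips one atom and leaves `spine A ++ Γ`, the context on which later
-- inductions recurse.
frᶜ-∷ : ∀ (A : Formula Atom) Γ → frᶜ (A ∷ Γ) ≡ first A ∷ frᶜ (spine A ++ Γ)
frᶜ-∷ (atom p) Γ = refl
frᶜ-∷ (A • B)  Γ = begin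
  (fr A ++ fr B) ++ frᶜ Γ                 ≡⟨ ++-assoc (fr A) (fr B) (frᶜ Γ) ⟩
  frᶜ (A ∷ B ∷ Γ)                         ≡⟨ frᶜ-∷ A (B ∷ Γ) ⟩
  first A ∷ frᶜ (spine A ++ B ∷ Γ)        ≡⟨ cong (λ Δ → first A ∷ frᶜ Δ) (++-assoc (spine A) [ B ] Γ) ⟨
  first A ∷ frᶜ ((spine A ++ [ B ]) ++ Γ) ∎
  where open ≡-Reasoning

fr-spine : ∀ (A : Formula Atom) → fr A ≡ first A ∷ frᶜ (spine A)
fr-spine A = begin
  fr A                          ≡⟨ ++-identityʳ (fr A) ⟨
  frᶜ [ A ]                     ≡⟨ frᶜ-∷ A [] ⟩
  first A ∷ frᶜ (spine A ++ []) ≡⟨ cong (λ Δ → first A ∷ frᶜ Δ) (++-identityʳ (spine A)) ⟩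
  first A ∷ frᶜ (spine A)       ∎
  where open ≡-Reasoning

formula-ext : ∀ {A B : Formula Atom} → first A ≡ first B → spine A ≡ spine B → A ≡ B
formula-ext {A = A} {B} p≡q Γ≡Δ =
  ≡.trans (η A) (≡.trans (cong₂ (λ p → atom p •⋆_) p≡q Γ≡Δ) (sym (η B)))
  where
  η : ∀ A → A ≡ atom (first A) •⋆ spine A
  η (atom p) = refl
  η (A • B)  = ≡.trans (cong (_• B) (η A)) (sym (foldl-∷ʳ _•_ (atom (first A)) B (spine A)))

-- Derivability and the Tamari order

•⋆-mono : ∀ Γ → A ≤Tamari B → A •⋆ Γ ≤Tamari B •⋆ Γ
•⋆-mono []      A≤B = A≤B
•⋆-mono (C ∷ Γ) A≤B = •⋆-mono Γ (mono A≤B refl)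

•⋆-assoc : ∀ (A B : Formula Atom) Γ → (A • B) •⋆ Γ ≤Tamari A • (B •⋆ Γ)
•⋆-assoc A B []      = refl
•⋆-assoc A B (C ∷ Γ) = trans (•⋆-mono Γ assoc) (•⋆-assoc A (B • C) Γ)

-- A sequent read as a Tamari inequality, the antecedent being a left-nested product; `⊥` because an
-- empty antecedent derives nothing.
Below : {Atom : Set a} → Context Atom → Formula Atom → Set a
Below []      B = ⊥
Below (A ∷ Γ) B = A •⋆ Γ ≤Tamari B

-- `•L` does not change the left-nested product, `•R` follows from `•⋆-assoc` and monotonicity, and
-- cut from transitivity once the cut block is regrouped.
⊢⇒Below : Γ ⊢ B → Below Γ B
⊢⇒Below (•L d) = ⊢⇒Below d
⊢⇒Below (•R {Γ = A ∷ Γ} {Δ = B ∷ Δ} d e) =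
  subst (_≤Tamari _) (sym (foldl-++ _•_ A Γ (B ∷ Δ)))
    (trans (•⋆-assoc (A •⋆ Γ) B Δ) (mono (⊢⇒Below d) (⊢⇒Below e)))
⊢⇒Below (•R {Γ = []} d e) with () ← ⊢⇒Below d
⊢⇒Below (•R {Γ = _ ∷ _} {Δ = []} d e) with () ← ⊢⇒Below e
⊢⇒Below id = refl
⊢⇒Below (cut {Γ = G ∷ Γ} {Θ = []} d e) with () ← ⊢⇒Below d
⊢⇒Below (cut {Γ = []} {Θ = []} d e) with () ← ⊢⇒Below d
⊢⇒Below (cut {Γ = []} {Θ = T ∷ Θ} {Δ} d e) =
  subst (_≤Tamari _) (sym (foldl-++ _•_ T Θ Δ)) (trans (•⋆-mono Δ (⊢⇒Below d)) (⊢⇒Below e))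
-- `•⋆-assoc` gathers the block `T ∷ Θ` into one right factor, which `d` then replaces by `A`.
⊢⇒Below (cut {Γ = G ∷ Γ} {Θ = T ∷ Θ} {Δ} {A} {B} d e) = subst (_≤Tamari _) (sym regroup)
  (trans (•⋆-mono Δ (trans (•⋆-assoc (G •⋆ Γ) T Θ) (mono refl (⊢⇒Below d))))
         (subst (_≤Tamari B) (foldl-++ _•_ G Γ (A ∷ Δ)) (⊢⇒Below e)))
  where
  regroup : G •⋆ (Γ ++ T ∷ Θ ++ Δ) ≡ (((G •⋆ Γ) • T) •⋆ Θ) •⋆ Δ
  regroup = ≡.trans (foldl-++ _•_ G Γ (T ∷ Θ ++ Δ)) (foldl-++ _•_ ((G •⋆ Γ) • T) Θ Δ)

Tamari⇒⊢ : A ≤Tamari B → [ A ] ⊢ B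
Tamari⇒⊢ refl        = id
Tamari⇒⊢ (trans d e) = cut {Γ = []} (Tamari⇒⊢ d) (Tamari⇒⊢ e)
Tamari⇒⊢ assoc       = •L (•L (•R id (•R id id)))
Tamari⇒⊢ (mono d e)  = •L (•R (Tamari⇒⊢ d) (Tamari⇒⊢ e))

Tamari⇒fr≡ : A ≤Tamari B → fr A ≡ fr B
Tamari⇒fr≡ refl                = refl
Tamari⇒fr≡ (trans d e)         = ≡.trans (Tamari⇒fr≡ d) (Tamari⇒fr≡ e)
Tamari⇒fr≡ (assoc {A} {B} {C}) = ++-assoc (fr A) (fr B) (fr C)
Tamari⇒fr≡ (mono d e)          = cong₂ _++_ (Tamari⇒fr≡ d) (Tamari⇒fr≡ e)

Tamari⇒first≡ : A ≤Tamari B → first A ≡ first B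
Tamari⇒first≡ refl        = refl
Tamari⇒first≡ (trans d e) = ≡.trans (Tamari⇒first≡ d) (Tamari⇒first≡ e)
Tamari⇒first≡ assoc       = refl
Tamari⇒first≡ (mono d _)  = Tamari⇒first≡ d

⊢⇒fr≡ : Γ ⊢ B → frᶜ Γ ≡ fr B
⊢⇒fr≡ {Γ = []}    d with () ← ⊢⇒Below d
⊢⇒fr≡ {Γ = A ∷ Γ} d = ≡.trans (sym (fr-•⋆ A Γ)) (Tamari⇒fr≡ (⊢⇒Below d))

-- Repeated `•L` down the left spine, where the product to decompose is always leftmost.
unfoldˡ : ∀ (A : Formula Atom) {Γ} → atom (first A) ∷ spine A ++ Γ ⊢ B → A ∷ Γ ⊢ B
unfoldˡ (atom p) d = d
unfoldˡ (A • C) {Γ} d =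
  •L (unfoldˡ A (subst (λ Δ → atom (first A) ∷ Δ ⊢ _) (++-assoc (spine A) [ C ] Γ) d))

spine-⊢ : ∀ (B : Formula Atom) → atom (first B) ∷ spine B ⊢ B
spine-⊢ (atom p) = id
spine-⊢ (A • B)  = •R (spine-⊢ A) id

-- The substitution order in canonical form

infix  4 _≼_
infixr 5 _∷_

-- Nested `concat`s are flattened: the left context is cut into blocks, one for each formula on the
-- right, which makes inversion possible.
data _≼_ {Atom : Set a} : Rel (Context Atom) a where
  []  : [] ≼ []
  _∷_ : ∀ {Γ A Γ′ Δ} → Γ ⊢ A → Γ′ ≼ Δ → Γ ++ Γ′ ≼ A ∷ Δ

≼-++ : Γ₁ ≼ Δ₁ → Γ₂ ≼ Δ₂ → Γ₁ ++ Γ₂ ≼ Δ₁ ++ Δ₂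
≼-++ []                           s = s
≼-++ (_∷_ {Γ = Γ} {Γ′ = Γ′} d r) s =
  subst (_≼ _) (sym (++-assoc Γ Γ′ _)) (d ∷ ≼-++ r s)

≼-[] : Γ ⊢ A → Γ ≼ [ A ]
≼-[] d = subst (_≼ _) (++-identityʳ _) (d ∷ [])

≼-refl : Γ ≼ Γ
≼-refl {Γ = []}    = []
≼-refl {Γ = A ∷ Γ} = id ∷ ≼-refl

≼-reflexive : Γ ≡ Δ → Γ ≼ Δ
≼-reflexive refl = ≼-refl

-- Cuts pull back along the order, because each formula on the right owns a whole block on the left.
≼-split : ∀ Δ₁ → Γ ≼ Δ₁ ++ Δ₂ → ∃₂ λ Γ₁ Γ₂ → Γ ≡ Γ₁ ++ Γ₂ × Γ₁ ≼ Δ₁ × Γ₂ ≼ Δ₂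
≼-split []       r = [] , _ , refl , [] , r
≼-split (A ∷ Δ₁) (_∷_ {Γ = Γ} d r) with Γ₁ , Γ₂ , refl , r₁ , r₂ ← ≼-split Δ₁ r =
  Γ ++ Γ₁ , Γ₂ , sym (++-assoc Γ Γ₁ Γ₂) , d ∷ r₁ , r₂

-- Stated for a variable left side: matching with `_ ∷ _` there would have to unify it with a
-- concatenation.
≼-∷⁻ : Γ ≼ A ∷ Δ → ∃₂ λ Γ₁ Γ₂ → Γ ≡ Γ₁ ++ Γ₂ × Γ₁ ⊢ A × Γ₂ ≼ Δ
≼-∷⁻ (d ∷ r) = _ , _ , refl , d , r

-- One cut for each formula of `Δ`, the rightmost first; `Ξ` is the prefix left untouched.
≼-⊢-trans : ∀ Ξ → Γ ≼ Δ → Ξ ++ Δ ⊢ C → Ξ ++ Γ ⊢ C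
≼-⊢-trans Ξ [] e = e
≼-⊢-trans Ξ (_∷_ {A = A} d r) e = cut {Γ = Ξ} d
  (subst (_⊢ _) (++-assoc Ξ [ A ] _)
    (≼-⊢-trans (Ξ ++ [ A ]) r (subst (_⊢ _) (sym (++-assoc Ξ [ A ] _)) e)))

≼-trans : Γ ≼ Δ → Δ ≼ Θ → Γ ≼ Θ
≼-trans r []                 = r
≼-trans r (_∷_ {Γ = Δ₁} d s) with _ , _ , refl , r₁ , r₂ ← ≼-split Δ₁ r =
  ≼-⊢-trans [] r₁ d ∷ ≼-trans r₂ s

≼⇒fr≡ : Γ ≼ Δ → frᶜ Γ ≡ frᶜ Δ
≼⇒fr≡ [] = refl
≼⇒fr≡ (_∷_ {Γ = Γ} d r) = ≡.trans (frᶜ-++ Γ _) (cong₂ _++_ (⊢⇒fr≡ d) (≼⇒fr≡ r))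

subst⇒≼ : Γ ≤subst Δ → Γ ≼ Δ
subst⇒≼ (derivable d) = ≼-[] d
subst⇒≼ empty         = []
subst⇒≼ (concat r s)  = ≼-++ (subst⇒≼ r) (subst⇒≼ s)

≼⇒subst : Γ ≼ Δ → Γ ≤subst Δ
≼⇒subst []      = empty
≼⇒subst (d ∷ r) = concat (derivable d) (≼⇒subst r)

-- Half of the order isomorphism: an associativity step merges the right factors `B` and `C` into
-- `B • C`, and a step inside a right factor becomes a derivation.
spine-mono : A ≤Tamari B → spine A ≼ spine B
spine-mono refl        = ≼-refl
spine-mono (trans d e) = ≼-trans (spine-mono d) (spine-mono e)
spine-mono (assoc {A} {B} {C}) = 
  subst (_≼ spine A ++ [ B • C ]) (sym (++-assoc (spine A) [ B ] [ C ]))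
    (≼-++ (≼-refl {Γ = spine A}) (≼-[] (•R id id)))
spine-mono (mono d e)  = ≼-++ (spine-mono d) (≼-[] (Tamari⇒⊢ e))

⊢⇒spine≼ : A ∷ Γ ⊢ B → spine A ++ Γ ≼ spine B
⊢⇒spine≼ {A = A} {Γ} d = subst (_≼ _) (spine-•⋆ A Γ) (spine-mono (⊢⇒Below d))

-- The other half: `B` is rebuilt from its first atom and spine, cuts replace that spine, and
-- `unfoldˡ` reassembles `A`.
spine≼⇒⊢ : first A ≡ first B → spine A ++ Γ ≼ spine B → A ∷ Γ ⊢ B
spine≼⇒⊢ {A = A} {B} p≡q r =
  unfoldˡ A (≼-⊢-trans [ _ ] r (subst (λ p → atom p ∷ spine B ⊢ B) (sym p≡q) (spine-⊢ B)))

spine≼⇒Tamari : first A ≡ first B → spine A ≼ spine B → A ≤Tamari B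
spine≼⇒Tamari {A = A} {B} p≡q r =
  ⊢⇒Below (spine≼⇒⊢ {A = A} p≡q (subst (_≼ spine B) (sym (++-identityʳ (spine A))) r))

-- Sizes and cut points of contexts

-- Counted in atoms, not formulas, so as to be invariant under `≼`; a cut point is measured by the
-- size of the part before it.
size : Context Atom → ℕ
size Γ = length (frᶜ Γ)

size-++ : ∀ (Γ Δ : Context Atom) → size (Γ ++ Δ) ≡ size Γ + size Δ
size-++ Γ Δ = ≡.trans (cong length (frᶜ-++ Γ Δ)) (length-++ (frᶜ Γ))

size-∷ : ∀ (A : Formula Atom) Γ → size (A ∷ Γ) ≡ length (fr A) + size Γ
size-∷ A Γ = length-++ (fr A)

≼⇒size≡ : Γ ≼ Δ → size Γ ≡ size Δ
≼⇒size≡ r = cong length (≼⇒fr≡ r)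

++≼⇒size≤ : ∀ (Γ₁ : Context Atom) {Γ₂ Θ} → Γ₁ ++ Γ₂ ≼ Θ → size Γ₁ ≤ size Θ
++≼⇒size≤ Γ₁ {Γ₂} r =
  subst (size Γ₁ ≤_) (≡.trans (sym (size-++ Γ₁ Γ₂)) (≼⇒size≡ r)) (m≤m+n _ _)

size-∷≰0 : ∀ (A : Formula Atom) Γ → ¬ size (A ∷ Γ) ≤ 0
size-∷≰0 A Γ le with () ← subst (λ Ω → length Ω ≤ 0) (frᶜ-∷ A Γ) le

-- Every formula has positive size, so sizes locate the cut points of a fixed context.
size-prefix : ∀ (Δ₁ Γ₁ : Context Atom) {Δ₂ Γ₂} → Δ₁ ++ Δ₂ ≡ Γ₁ ++ Γ₂ → size Δ₁ ≤ size Γ₁ →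
  ∃ λ Θ → Γ₁ ≡ Δ₁ ++ Θ × Δ₂ ≡ Θ ++ Γ₂
size-prefix []       Γ₁       eq le = Γ₁ , refl , eq
size-prefix (A ∷ Δ₁) []       eq le = contradiction le (size-∷≰0 A Δ₁)
size-prefix (A ∷ Δ₁) (B ∷ Γ₁) eq le with refl , eq′ ← ∷-injective eq
  with Θ , refl , refl ← size-prefix Δ₁ Γ₁ eq′ (+-cancelˡ-≤ (length (fr A)) _ _
         (≡.subst₂ _≤_ (size-∷ A Δ₁) (size-∷ A Γ₁) le)) = Θ , refl , refl

++-injective-size : ∀ (Δ₁ Γ₁ : Context Atom) {Δ₂ Γ₂} → Δ₁ ++ Δ₂ ≡ Γ₁ ++ Γ₂ →
  size Δ₁ ≡ size Γ₁ → Δ₁ ≡ Γ₁ × Δ₂ ≡ Γ₂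
++-injective-size Δ₁ Γ₁ eq sz with size-prefix Δ₁ Γ₁ eq (≤-reflexive sz)
... | []    , refl , refl = sym (++-identityʳ Δ₁) , refl
... | A ∷ Θ , refl , refl =
  contradiction (+-cancelˡ-≤ (size Δ₁) _ _ (≤-reflexive no-rest)) (size-∷≰0 A Θ)
  where
  no-rest : size Δ₁ + size (A ∷ Θ) ≡ size Δ₁ + 0
  no-rest = ≡.trans (sym (size-++ Δ₁ (A ∷ Θ))) (≡.trans (sym sz) (sym (+-identityʳ _)))

leastCut : ∀ (Θ : Context Atom) k → k ≤ size Θ → ∃₂ λ Θ₁ Θ₂ →
  Θ ≡ Θ₁ ++ Θ₂ × k ≤ size Θ₁ × (∀ Ξ₁ Ξ₂ → Θ ≡ Ξ₁ ++ Ξ₂ → k ≤ size Ξ₁ → size Θ₁ ≤ size Ξ₁)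
leastCut Θ       zero    _  = [] , Θ , refl , z≤n , λ _ _ _ _ → z≤n
leastCut (A ∷ Θ) (suc k) le
  -- If `A` alone reaches `suc k`, truncated subtraction gives zero and the cut falls right after
  -- `A`.
  with Θ₁ , Θ₂ , refl , k≤ , least ← leastCut Θ (suc k ∸ length (fr A))
         (m≤n+o⇒m∸n≤o (suc k) (length (fr A)) (subst (suc k ≤_) (size-∷ A Θ) le)) =
  A ∷ Θ₁ , Θ₂ , refl
  , subst (suc k ≤_) (sym (size-∷ A Θ₁))
      (≤-trans (m≤n+m∸n (suc k) (length (fr A))) (+-monoʳ-≤ (length (fr A)) k≤))
  , minimal
  where
  minimal : ∀ Ξ₁ Ξ₂ → A ∷ Θ₁ ++ Θ₂ ≡ Ξ₁ ++ Ξ₂ → suc k ≤ size Ξ₁ → size (A ∷ Θ₁) ≤ size Ξ₁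
  minimal (B ∷ Ξ₁) Ξ₂ eq k<Ξ with refl , eq′ ← ∷-injective eq =
    ≡.subst₂ _≤_ (sym (size-∷ A Θ₁)) (sym (size-∷ A Ξ₁))
      (+-monoʳ-≤ (length (fr A)) (least Ξ₁ Ξ₂ eq′
        (m≤n+o⇒m∸n≤o (suc k) (length (fr A)) (subst (suc k ≤_) (size-∷ A Ξ₁) k<Ξ))))

-- Contexts as contexts with a cut point

-- Exposes the frontier as an index, so that recursion is structural in `Ω` although `spine A ++ Γ`
-- is no subterm of `A ∷ Γ`.
data View {Atom : Set a} : Context Atom → List Atom → Set a where
  []   : View [] []
  cons : ∀ {A Γ p Ω} → first A ≡ p → frᶜ (spine A ++ Γ) ≡ Ω → View (A ∷ Γ) (p ∷ Ω)

view : ∀ (Γ : Context Atom) {Ω} → frᶜ Γ ≡ Ω → View Γ Ω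
view []      refl = []
view (A ∷ Γ) refl = subst (View (A ∷ Γ)) (sym (frᶜ-∷ A Γ)) (cons refl refl)

-- With `∷≼∷⁻`, this splits the order on non-empty contexts into the order on unfolded contexts and
-- that on cut points.
∷≼∷⁺ : ∀ {A B : Formula Atom} {Γ Δ} → first A ≡ first B →
  spine A ++ Γ ≼ spine B ++ Δ → size (spine A) ≤ size (spine B) → A ∷ Γ ≼ B ∷ Δ
∷≼∷⁺ {A = A} {B} p≡q r le
  -- The cut after `spine B` pulls back to one no earlier than that after `spine A`; the formulas in
  -- between join `A` in deriving `B`.
  with Ξ₁ , Ξ₂ , eq , r₁ , r₂ ← ≼-split (spine B) r
  with Γ₁ , refl , refl ← size-prefix (spine A) Ξ₁ eq
         (subst (size (spine A) ≤_) (sym (≼⇒size≡ r₁)) le)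
  = spine≼⇒⊢ p≡q r₁ ∷ r₂

∷≼∷⁻ : ∀ {A B : Formula Atom} {Γ Δ} → A ∷ Γ ≼ B ∷ Δ →
  spine A ++ Γ ≼ spine B ++ Δ × size (spine A) ≤ size (spine B)
∷≼∷⁻ {A = A} r with ≼-∷⁻ r
... | []     , _  , _    , d , _ with () ← ⊢⇒Below d
... | _ ∷ Γ₁ , Γ₂ , refl , d , s =
  subst (_≼ _) (++-assoc (spine A) Γ₁ Γ₂) (≼-++ (⊢⇒spine≼ d) s)
  , subst (size (spine A) ≤_) (≡.trans (sym (size-++ (spine A) Γ₁)) (≼⇒size≡ (⊢⇒spine≼ d)))
      (m≤m+n _ _)

≼-antisym : Γ ≼ Δ → Δ ≼ Γ → Γ ≡ Δ
≼-antisym {Γ = Γ} {Δ} r s = go _ (view Γ refl) (view Δ (sym (≼⇒fr≡ r))) r s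
  where
  go : ∀ {Γ Δ} Ω → View Γ Ω → View Δ Ω → Γ ≼ Δ → Δ ≼ Γ → Γ ≡ Δ
  go [] [] [] _ _ = refl
  go (p ∷ Ω) (cons {A} {Γ} p≡ Γ≡) (cons {B} {Δ} q≡ Δ≡) r s
    with r′ , le ← ∷≼∷⁻ r | s′ , ge ← ∷≼∷⁻ s
    with spine≡ , refl ← ++-injective-size (spine A) (spine B)
           (go Ω (view (spine A ++ Γ) Γ≡) (view (spine B ++ Δ) Δ≡) r′ s′) (≤-antisym le ge)
    = cong (_∷ _) (formula-ext (≡.trans p≡ (sym q≡)) spine≡)

-- Meets and joins of contexts

≼-glb : ∀ {Γ Δ : Context Atom} → frᶜ Γ ≡ frᶜ Δ → GLB _≼_ Γ Δ
≼-glb {Γ = Γ} {Δ} eq = go _ (view Γ eq) (view Δ refl)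
  where
  -- The first formula of Γ has the smaller cut point, which is therefore
  -- also a cut point of the meet Θ.
  extend : ∀ {A B : Formula Atom} {Γ Δ} → first A ≡ first B →
    size (spine A) ≤ size (spine B) →
    GLB _≼_ (spine A ++ Γ) (spine B ++ Δ) → GLB _≼_ (A ∷ Γ) (B ∷ Δ)
  extend {A = A} {B} {Γ} {Δ} p≡q le (Θ , Θ≼Γ , Θ≼Δ , greatest)
    with Θ₁ , Θ₂ , refl , r₁ , r₂ ← ≼-split (spine A) Θ≼Γ
    = M ∷ Θ₂
    , spine≼⇒⊢ first-M (≼-trans (≼-reflexive (≡.trans (++-identityʳ _) spine-M)) r₁) ∷ r₂
    , ∷≼∷⁺ (≡.trans first-M p≡q) (subst (λ Ξ → Ξ ++ Θ₂ ≼ spine B ++ Δ) (sym spine-M) Θ≼Δ)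
        (≤-trans (≤-reflexive size-M) le)
    , below
    where
    M = atom (first A) •⋆ Θ₁

    first-M : first M ≡ first A
    first-M = first-•⋆ (atom (first A)) Θ₁

    spine-M : spine M ≡ Θ₁
    spine-M = spine-•⋆ (atom (first A)) Θ₁

    size-M : size (spine M) ≡ size (spine A)
    size-M = ≡.trans (cong size spine-M) (≼⇒size≡ r₁)

    below : ∀ Ξ → Ξ ≼ A ∷ Γ → Ξ ≼ B ∷ Δ → Ξ ≼ M ∷ Θ₂
    below Ξ r s with view Ξ (≡.trans (≼⇒fr≡ r) (frᶜ-∷ A Γ))
    ... | cons p≡ _ with r′ , ≤A ← ∷≼∷⁻ r | s′ , _ ← ∷≼∷⁻ s =
      ∷≼∷⁺ (≡.trans p≡ (sym first-M))
        (subst (λ Ψ → _ ≼ Ψ ++ Θ₂) (sym spine-M) (greatest _ r′ s′))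
        (≤-trans ≤A (≤-reflexive (sym size-M)))

  go : ∀ {Γ Δ} Ω → View Γ Ω → View Δ Ω → GLB _≼_ Γ Δ
  go [] [] [] = [] , [] , [] , λ _ r _ → r
  go (p ∷ Ω) (cons {A} {Γ} p≡ Γ≡) (cons {B} {Δ} q≡ Δ≡)
    with meet ← go Ω (view (spine A ++ Γ) Γ≡) (view (spine B ++ Δ) Δ≡)
    with ≤-total (size (spine A)) (size (spine B))
  ... | inj₁ le = extend (≡.trans p≡ (sym q≡)) le meet
  ... | inj₂ ge = GLB-sym (extend (≡.trans q≡ (sym p≡)) ge (GLB-sym meet))

≼-lub : ∀ {Γ Δ : Context Atom} → frᶜ Γ ≡ frᶜ Δ → LUB _≼_ Γ Δ
≼-lub {Γ = Γ} {Δ} eq = go _ (view Γ eq) (view Δ refl)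
  where
  go : ∀ {Γ Δ} Ω → View Γ Ω → View Δ Ω → LUB _≼_ Γ Δ
  go [] [] [] = [] , [] , [] , λ _ r _ → r
  go (p ∷ Ω) (cons {A} {Γ} p≡ Γ≡) (cons {B} {Δ} q≡ Δ≡)
    with Θ , Γ≼Θ , Δ≼Θ , least ← go Ω (view (spine A ++ Γ) Γ≡) (view (spine B ++ Δ) Δ≡)
    -- `Θ` may have no cut at the larger of the two spine sizes, so the next available one is taken.
    with Θ₁ , Θ₂ , refl , k≤ , leastSize ← leastCut Θ (size (spine A) ⊔ size (spine B))
           (⊔-lub (++≼⇒size≤ (spine A) Γ≼Θ) (++≼⇒size≤ (spine B) Δ≼Θ))
    = J ∷ Θ₂
    , ∷≼∷⁺ (≡.trans p≡ (sym first-J)) (subst (λ Ψ → _ ≼ Ψ ++ Θ₂) (sym spine-J) Γ≼Θ)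
        (subst (λ Ψ → _ ≤ size Ψ) (sym spine-J) (≤-trans (m≤m⊔n _ _) k≤))
    , ∷≼∷⁺ (≡.trans q≡ (sym first-J)) (subst (λ Ψ → _ ≼ Ψ ++ Θ₂) (sym spine-J) Δ≼Θ)
        (subst (λ Ψ → _ ≤ size Ψ) (sym spine-J) (≤-trans (m≤n⊔m _ _) k≤))
    , above
    where
    J = atom p •⋆ Θ₁

    first-J : first J ≡ p
    first-J = first-•⋆ (atom p) Θ₁

    spine-J : spine J ≡ Θ₁
    spine-J = spine-•⋆ (atom p) Θ₁

    above : ∀ Ξ → A ∷ Γ ≼ Ξ → B ∷ Δ ≼ Ξ → J ∷ Θ₂ ≼ Ξ
    above [] ()
    above (C ∷ Ξ) r s
      with r′ , A≤ ← ∷≼∷⁻ r | s′ , B≤ ← ∷≼∷⁻ s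
      with Θ≼Ξ ← least _ r′ s′
      -- The cut after `spine C` pulls back to a cut of `Θ` beyond both given ones, hence no earlier
      -- than the least such cut.
      with Ψ₁ , Ψ₂ , eq , t , _ ← ≼-split (spine C) Θ≼Ξ
      = ∷≼∷⁺ first≡ (subst (λ Ψ → Ψ ++ Θ₂ ≼ _) (sym spine-J) Θ≼Ξ)
          (subst (λ Ψ → size Ψ ≤ _) (sym spine-J)
            (subst (size Θ₁ ≤_) (≼⇒size≡ t)
              (leastSize Ψ₁ Ψ₂ eq (subst (_ ≤_) (sym (≼⇒size≡ t)) (⊔-lub A≤ B≤)))))
      where
      first≡ : first J ≡ first C
      first≡ = ≡.trans first-J (≡.trans (sym p≡)
        (∷-injectiveˡ (≡.trans (sym (frᶜ-∷ A Γ)) (≡.trans (≼⇒fr≡ r) (frᶜ-∷ C Ξ)))))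

-- Transfer to the substitution and Tamari orders

subst-isPartialOrder : {Atom : Set a} → IsPartialOrder _≡_ (_≤subst_ {Atom = Atom})
subst-isPartialOrder = record
  { isPreorder = record
    { isEquivalence = ≡.isEquivalence
    ; reflexive     = λ eq → ≼⇒subst (≼-reflexive eq)
    ; trans         = λ r s → ≼⇒subst (≼-trans (subst⇒≼ r) (subst⇒≼ s))
    }
  ; antisym = λ r s → ≼-antisym (subst⇒≼ r) (subst⇒≼ s)
  }

subst-glb : ∀ {Γ Δ : Context Atom} → frᶜ Γ ≡ frᶜ Δ → GLB _≤subst_ Γ Δ
subst-glb eq = let Θ , r , s , greatest = ≼-glb eq in
  Θ , ≼⇒subst r , ≼⇒subst s , λ Ξ t u → ≼⇒subst (greatest Ξ (subst⇒≼ t) (subst⇒≼ u))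

subst-lub : ∀ {Γ Δ : Context Atom} → frᶜ Γ ≡ frᶜ Δ → LUB _≤subst_ Γ Δ
subst-lub eq = let Θ , r , s , least = ≼-lub eq in
  Θ , ≼⇒subst r , ≼⇒subst s , λ Ξ t u → ≼⇒subst (least Ξ (subst⇒≼ t) (subst⇒≼ u))

Tamari-isPartialOrder : {Atom : Set a} → IsPartialOrder _≡_ (_≤Tamari_ {Atom = Atom})
Tamari-isPartialOrder = record
  { isPreorder = record
    { isEquivalence = ≡.isEquivalence
    ; reflexive     = λ { refl → refl }
    ; trans         = trans
    }
  ; antisym = λ d e → formula-ext (Tamari⇒first≡ d) (≼-antisym (spine-mono d) (spine-mono e))
  }

module _ {A B : Formula Atom} (eq : fr A ≡ fr B) where

  private
    first×frᶜ-spine : first A ≡ first B × frᶜ (spine A) ≡ frᶜ (spine B)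
    first×frᶜ-spine = ∷-injective (≡.trans (sym (fr-spine A)) (≡.trans eq (fr-spine B)))

    first≡ = proj₁ first×frᶜ-spine

    node : Context Atom → Formula Atom
    node Θ = atom (first A) •⋆ Θ

    first-node : ∀ Θ → first (node Θ) ≡ first A
    first-node Θ = first-•⋆ (atom (first A)) Θ

    spine-node : ∀ Θ → spine (node Θ) ≡ Θ
    spine-node Θ = spine-•⋆ (atom (first A)) Θ

    node≤ : ∀ {Θ C} → first A ≡ first C → Θ ≼ spine C → node Θ ≤Tamari C
    node≤ {Θ} p≡q r =
      spine≼⇒Tamari (≡.trans (first-node Θ) p≡q) (subst (_≼ _) (sym (spine-node Θ)) r)

    ≤node : ∀ {Θ C} → first C ≡ first A → spine C ≼ Θ → C ≤Tamari node Θ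
    ≤node {Θ} p≡q r =
      spine≼⇒Tamari (≡.trans p≡q (sym (first-node Θ))) (subst (_ ≼_) (sym (spine-node Θ)) r)

  -- Formulas with a common first atom are ordered as their spines, so the meet of the spines
  -- becomes a formula under `node`.
  Tamari-glb : GLB _≤Tamari_ A B
  Tamari-glb = let Θ , r , s , greatest = ≼-glb (proj₂ first×frᶜ-spine) in
    node Θ , node≤ refl r , node≤ first≡ s ,
    λ C d e → ≤node (Tamari⇒first≡ d) (greatest (spine C) (spine-mono d) (spine-mono e))

  Tamari-lub : LUB _≤Tamari_ A B
  Tamari-lub = let Θ , r , s , least = ≼-lub (proj₂ first×frᶜ-spine) in
    node Θ , ≤node refl r , ≤node (sym first≡) s ,
    λ C d e → node≤ (Tamari⇒first≡ d) (least (spine C) (spine-mono d) (spine-mono e))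

theorem2p17 : ∀ {a} {Atom : Set a} (Ω : List Atom) → Ω ≢ [] →
    FormsLattice (FrmEq Ω) (FrmOrder Ω) × FormsLattice (CtxEq Ω) (CtxOrder Ω)
theorem2p17 Ω _ =
    fibreLattice fr Ω Tamari-isPartialOrder Tamari⇒fr≡ Tamari-glb Tamari-lub
  , fibreLattice frᶜ Ω subst-isPartialOrder
      (λ r → ≼⇒fr≡ (subst⇒≼ r)) subst-glb subst-lub
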